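{- For all $s,t,w\in\mathbb{N}$ there exists $\eta\in\mathbb{N}$ such that every graph with treewidth at most $w$ and with no $K_{s,t}$ subgraph is $(s+1)$-colorable with clustering $\eta$.
   Context: $\mathbb{N}=\{1,2,\dots\}$. Graphs are finite and may have loops and parallel edges; subgraphs are not required to be induced. A coloring of a graph $G$ is any function assigning one color to each vertex of $G$ (not necessarily proper). A monochromatic component is a connected component of the subgraph of $G$ induced by all the vertices assigned a single color. A coloring has clustering $\eta$ if every monochromatic component has at most $\eta$ vertices. $G$ is $k$-colorable with clustering $\eta$ if $G$ has a coloring with at most $k$ colors and clustering $\eta$. Treewidth is the usual notion (minimum over tree decompositions of the maximum bag size minus 1). -}

module Defs where

open import Data.Fin.Base using (Fin; zero; suc; inject₁; fromℕ; remQuot; _↑ˡ_; _↑ʳ_)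
open import Data.Fin.Subset using (Subset; _∈_; _⊆_; ∣_∣; Nonempty)
open import Data.Nat.Base using (ℕ; suc; _+_; _*_; _∸_; _≤_; _⊔_)
open import Data.Product.Base using (Σ-syntax; ∃-syntax; _×_; _,_; proj₁; proj₂)
open import Data.Sum.Base using (_⊎_)
import Data.Vec.Functional as Vector
open import Function.Definitions using (Injective)
open import Level using (0ℓ)
open import Relation.Binary.Construct.Closure.ReflexiveTransitive using (Star)
open import Relation.Binary.PropositionalEquality using (_≡_)
open import Relation.Nullary using (¬_)
open import Relation.Unary using (Pred; U)

-- Finite graphs, loops and parallel edges allowed.  Edges are undirected:
-- the order of the two ends is arbitrary and forgotten by `Joins`.
record Graph : Set where
  field
    #V   : ℕ
    #E   : ℕ
    ends : Fin #E → Fin #V × Fin #V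

  Vertex : Set
  Vertex = Fin #V

  Edge : Set
  Edge = Fin #E

open Graph public

Joins : (G : Graph) → Edge G → Vertex G → Vertex G → Set
Joins G e u v = (ends G e ≡ (u , v)) ⊎ (ends G e ≡ (v , u))

Adjacent : (G : Graph) → Vertex G → Vertex G → Set
Adjacent G u v = ∃[ e ] Joins G e u v

-- H is isomorphic to a (not necessarily induced) subgraph of G.
record _⊑_ (H G : Graph) : Set where
  field
    vertexMap           : Vertex H → Vertex G
    edgeMap             : Edge H → Edge G
    vertexMap-injective : Injective _≡_ _≡_ vertexMap
    edgeMap-injective   : Injective _≡_ _≡_ edgeMap
    preserves-ends      : ∀ e → Joins G (edgeMap e)
                                  (vertexMap (proj₁ (ends H e)))
                                  (vertexMap (proj₂ (ends H e)))

-- The complete bipartite graph K_{s,t}; `remQuot` is the bijection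
-- Fin (s * t) → Fin s × Fin t.
K : ℕ → ℕ → Graph
K s t = record
  { #V   = s + t
  ; #E   = s * t
  ; ends = λ e → (proj₁ (remQuot {s} t e) ↑ˡ t) , (s ↑ʳ proj₂ (remQuot {s} t e))
  }

-- The subgraph of G induced by P has a path between any two of its vertices
-- (vacuously true when P is empty).
ConnectedOn : (G : Graph) → Pred (Vertex G) 0ℓ → Set
ConnectedOn G P = ∀ {u v} → P u → P v →
  Star (λ x y → P x × P y × Adjacent G x y) u v

-- A cycle of length 1 + k: distinct vertices v₀ … v_k and distinct edges
-- e₀ … e_k with e_i joining v_i to v_{i+1} and e_k joining v_k to v₀.
-- Thus a loop is a cycle of length 1, a pair of parallel edges one of length 2.
record Cycle (G : Graph) : Set where
  field
    k                : ℕ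
    vertex           : Fin (suc k) → Vertex G
    edge             : Fin (suc k) → Edge G
    vertex-injective : Injective _≡_ _≡_ vertex
    edge-injective   : Injective _≡_ _≡_ edge
    consecutive      : ∀ (i : Fin k) →
                       Joins G (edge (inject₁ i)) (vertex (inject₁ i)) (vertex (suc i))
    closing          : Joins G (edge (fromℕ k)) (vertex (fromℕ k)) (vertex zero)

record IsTree (T : Graph) : Set where
  field
    nonempty  : 1 ≤ #V T
    connected : ConnectedOn T U
    acyclic   : ¬ Cycle T

record TreeDecomposition (G : Graph) : Set where
  field
    tree          : Graph
    isTree        : IsTree tree
    bag           : Vertex tree → Subset (#V G)
    covers-vertex : ∀ v → ∃[ x ] v ∈ bag x
    covers-edge   : ∀ e → ∃[ x ] (proj₁ (ends G e) ∈ bag x × proj₂ (ends G e) ∈ bag x)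
    coherent      : ∀ v → ConnectedOn tree (λ x → v ∈ bag x)

  -- Truncated subtraction only matters if all bags are empty, i.e. G has no
  -- vertices; the width is then 0 rather than -1.
  width : ℕ
  width = Vector.foldr _⊔_ 0 (λ x → ∣ bag x ∣) ∸ 1

-- Treewidth is the minimum width of a tree decomposition, so it is at most w
-- exactly when some tree decomposition has width at most w.
Treewidth≤ : Graph → ℕ → Set
Treewidth≤ G w = Σ[ D ∈ TreeDecomposition G ] TreeDecomposition.width D ≤ w

-- C is the vertex set of a connected component (a maximal nonempty connected
-- subgraph) of the subgraph of G induced by P.
record IsComponent (G : Graph) (P : Pred (Vertex G) 0ℓ) (C : Subset (#V G)) : Set where
  field
    nonempty  : Nonempty C
    inside    : ∀ {v} → v ∈ C → P v
    connected : ConnectedOn G (_∈ C)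
    maximal   : ∀ D → (∀ {v} → v ∈ D → P v) → ConnectedOn G (_∈ D) → C ⊆ D → D ⊆ C

-- Not necessarily proper.
Coloring : Graph → ℕ → Set
Coloring G k = Vertex G → Fin k

MonochromaticComponent : (G : Graph) {k : ℕ} → Coloring G k → Subset (#V G) → Set
MonochromaticComponent G c C = ∃[ i ] IsComponent G (λ v → c v ≡ i) C

HasClustering : (G : Graph) {k : ℕ} → Coloring G k → ℕ → Set
HasClustering G c η = ∀ C → MonochromaticComponent G c C → ∣ C ∣ ≤ η

ColorableWithClustering : Graph → ℕ → ℕ → Set
ColorableWithClustering G k η = Σ[ c ∈ Coloring G k ] HasClustering G c η

{-# OPTIONS --safe #-}
module Submission where

-- Colours are never withdrawn, and a vertex is rich to a coloured set if it sees at least s of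
-- the s + 1 colours there.  As G has no K_{s,t}, a bounded set has boundedly many rich vertices;
-- a vertex that is not rich still has two colours to choose from.
--
-- Consider a set Z of uncoloured vertices with bounded coloured boundary B, and O ⊆ B such that
-- each vertex of Z misses a colour on O.  Going once through the colours i and giving i to all
-- vertices of Z that are rich to the coloured set and see no i on O, we colour a bounded set W
-- without monochromatic edges to O, after which each uncoloured vertex misses a colour on W ∪ B.
-- Enclose W ∪ B in a bounded set X, a union of bags whose nodes are closed under lowest common
-- ancestors, so that each part of Z ∖ X meets X only in the two bags next to it.  Colour the rest
-- of X and, recursively, the parts, always avoiding the colours of neighbours in W ∪ B; in the
-- recursion, W ∪ B plays the role of O.  A monochromatic component of Z ∖ W that meets X then
-- leaves X only through the sets W of the parts.  W is nonempty only in a part containing a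
-- vertex rich to X, so for boundedly many parts, and such a component is bounded although the
-- number of parts is not.

open import Data.Fin.Base using
  (Fin; zero; suc; inject₁; fromℕ; fromℕ<; inject≤; toℕ; punchIn; splitAt; remQuot; combine;
   _↑ˡ_; _↑ʳ_)
import Data.Fin.Properties as Finₚ
open import Data.Fin.Relation.Unary.Top using
  (View; ‵fromℕ; ‵inject₁; view; view-fromℕ; view-inject₁)
open import Data.Fin.Subset using (Subset; inside; outside; ⁅_⁆; _∪_; ∣_∣)
  renaming (_∈_ to _∈ₛ_; ⊥ to ∅)
import Data.Fin.Subset.Properties as Subsetₚ
open import Data.List.Base using
  (List; []; _∷_; _++_; length; map; cartesianProduct; cartesianProductWith; allFin; filter;
   lookup)
import Data.List.Membership.DecPropositional as DecMembership
open import Data.List.Membership.Propositional using (_∈_; _∉_; find; lose)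
open import Data.List.Membership.Propositional.Properties
import Data.List.Properties as Listₚ
import Data.List.Relation.Unary.All as All
open import Data.List.Relation.Unary.AllPairs using (_∷_)
open import Data.List.Relation.Unary.Any as Any using (here; there)
open import Data.List.Relation.Unary.Unique.Propositional using (Unique)
import Data.List.Relation.Unary.Unique.Propositional.Properties as Uniqueₚ
open import Data.Nat.Base using (ℕ; zero; suc; _+_; _*_; _^_; _≤_; _<_; _⊔_; z≤n; s≤s)
import Data.Nat.Properties as ℕₚ
open import Data.Product.Base using (∃-syntax; Σ-syntax; _×_; _,_; proj₁; proj₂)
open import Data.Product.Properties using (≡-dec)
open import Data.Sum.Base as Sum using (_⊎_; inj₁; inj₂; [_,_]′)
open import Data.Unit.Base using (tt)
open import Data.Vec.Base as Vec using (Vec; []; _∷_)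
import Data.Vec.Functional as Vector
import Data.Vec.Properties as Vecₚ
open import Function.Base using (_∘_; id; case_of_)
open import Function.Definitions using (Injective)
open import Relation.Binary.Construct.Closure.ReflexiveTransitive using
  (Star; ε; _◅_; _◅◅_; reverse)
open import Relation.Binary.PropositionalEquality
open import Relation.Nullary using (¬_; Dec; yes; no; contradiction)
open import Relation.Nullary.Decidable using
  (map′; _×-dec_; _⊎-dec_; _→-dec_; ¬?; decidable-stable)
open import Relation.Unary using (Decidable; U)
open import Defs


-- Adjacency and complete bipartite subgraphs.

module _ (G : Graph) where

  Adjacent-sym : ∀ {u v} → Adjacent G u v → Adjacent G v u
  Adjacent-sym (e , j) = e , Sum.swap j

  opaque
    adjacent? : ∀ u v → Dec (Adjacent G u v)
    adjacent? u v = Finₚ.any? λ e → ends G e ≟² (u , v) ⊎-dec ends G e ≟² (v , u)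
      where
      _≟²_ : (p q : Vertex G × Vertex G) → Dec (p ≡ q)
      _≟²_ = ≡-dec Finₚ._≟_ Finₚ._≟_

  Joins-unique : ∀ {e u v x y} → Joins G e u v → Joins G e x y →
                 (u ≡ x × v ≡ y) ⊎ (u ≡ y × v ≡ x)
  Joins-unique (inj₁ p) (inj₁ q) with refl ← trans (sym p) q = inj₁ (refl , refl)
  Joins-unique (inj₁ p) (inj₂ q) with refl ← trans (sym p) q = inj₂ (refl , refl)
  Joins-unique (inj₂ p) (inj₁ q) with refl ← trans (sym p) q = inj₂ (refl , refl)
  Joins-unique (inj₂ p) (inj₂ q) with refl ← trans (sym p) q = inj₁ (refl , refl)

  -- For each pair any joining edge will do. Different pairs get different edges: the images of `a`
  -- and `b` are disjoint, so the ends of an edge determine the pair.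
  K⊑ : ∀ {s t} (a : Fin s → Vertex G) (b : Fin t → Vertex G) →
       Injective _≡_ _≡_ a → Injective _≡_ _≡_ b →
       (∀ i j → a i ≢ b j) → (∀ i j → Adjacent G (a i) (b j)) → K s t ⊑ G
  K⊑ {s} {t} a b a-inj b-inj a≢b a~b = record
    { vertexMap           = f
    ; edgeMap             = g
    ; vertexMap-injective = f-inj
    ; edgeMap-injective   = λ {e} {e′} → g-inj e e′
    ; preserves-ends      = λ e → subst₂ (Joins G (g e))
        (sym (cong [ a , b ]′ (Finₚ.splitAt-↑ˡ s (left e) t)))
        (sym (cong [ a , b ]′ (Finₚ.splitAt-↑ʳ s t (right e))))
        (g-joins e)
    }
    where
    f : Fin (s + t) → Vertex G
    f v = [ a , b ]′ (splitAt s v)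

    f-inj : Injective _≡_ _≡_ f
    f-inj {u} {v} eq with splitAt s u in p | splitAt s v in q
    ... | inj₁ i | inj₁ j = trans (sym (Finₚ.splitAt⁻¹-↑ˡ p))
                              (trans (cong (_↑ˡ t) (a-inj eq)) (Finₚ.splitAt⁻¹-↑ˡ q))
    ... | inj₁ i | inj₂ j = contradiction eq (a≢b i j)
    ... | inj₂ i | inj₁ j = contradiction (sym eq) (a≢b j i)
    ... | inj₂ i | inj₂ j = trans (sym (Finₚ.splitAt⁻¹-↑ʳ p))
                              (trans (cong (s ↑ʳ_) (b-inj eq)) (Finₚ.splitAt⁻¹-↑ʳ q))

    left : Fin (s * t) → Fin s
    left e = proj₁ (remQuot {s} t e)

    right : Fin (s * t) → Fin t
    right e = proj₂ (remQuot {s} t e)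

    g : Fin (s * t) → Edge G
    g e = proj₁ (a~b (left e) (right e))

    g-joins : ∀ e → Joins G (g e) (a (left e)) (b (right e))
    g-joins e = proj₂ (a~b (left e) (right e))

    g-inj : ∀ e e′ → g e ≡ g e′ → e ≡ e′
    g-inj e e′ eq with Joins-unique (g-joins e)
                         (subst (λ x → Joins G x _ _) (sym eq) (g-joins e′))
    ... | inj₂ (p , _) = contradiction p (a≢b _ _)
    ... | inj₁ (p , q) = trans (sym (Finₚ.combine-remQuot {s} t e))
          (trans (cong₂ combine (a-inj p) (b-inj q)) (Finₚ.combine-remQuot {s} t e′))

-- Bounds on finite sets.

-- Finite sets are bounded by exhibiting a list that contains them.
Covered : {A : Set} → (A → Set) → ℕ → Set
Covered P n = ∃[ xs ] (length xs ≤ n × (∀ {x} → P x → x ∈ xs))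

Covered-⋃ : {A I : Set} {P : I → A → Set} {n : ℕ} (is : List I) →
            (∀ i → Covered (P i) n) →
            Covered (λ x → ∃[ i ] (i ∈ is × P i x)) (length is * n)
Covered-⋃ []       cov = [] , z≤n , λ { (_ , () , _) }
Covered-⋃ (i ∷ is) cov =
  let xs , xs≤ , xs∋ = cov i
      ys , ys≤ , ys∋ = Covered-⋃ is cov
  in xs ++ ys
   , subst (_≤ _) (sym (Listₚ.length-++ xs)) (ℕₚ.+-mono-≤ xs≤ ys≤)
   , λ { (_ , here refl , p) → ∈-++⁺ˡ (xs∋ p)
       ; (j , there j∈  , p) → ∈-++⁺ʳ xs (ys∋ (j , j∈ , p)) }

length-cartesianProductWith : {A B C : Set} (f : A → B → C) (xs : List A) (ys : List B) →
  length (cartesianProductWith f xs ys) ≡ length xs * length ys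
length-cartesianProductWith f []       ys = refl
length-cartesianProductWith f (x ∷ xs) ys = trans (Listₚ.length-++ (map (f x) ys))
  (cong₂ _+_ (Listₚ.length-map (f x) ys) (length-cartesianProductWith f xs ys))

tuples : {A : Set} (k : ℕ) → List A → List (Vec A k)
tuples zero    xs = [] ∷ []
tuples (suc k) xs = cartesianProductWith _∷_ xs (tuples k xs)

length-tuples : {A : Set} (k : ℕ) (xs : List A) → length (tuples k xs) ≡ length xs ^ k
length-tuples zero    xs = refl
length-tuples (suc k) xs = trans (length-cartesianProductWith _∷_ xs (tuples k xs))
  (cong (length xs *_) (length-tuples k xs))

∈-tuples : {A : Set} {xs : List A} {k : ℕ} (f : Fin k → A) → (∀ i → f i ∈ xs) →
           Vec.tabulate f ∈ tuples k xs
∈-tuples {k = zero}  f f∈ = here refl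
∈-tuples {k = suc k} f f∈ =
  ∈-cartesianProductWith⁺ _∷_ (f∈ zero) (∈-tuples (f ∘ suc) (f∈ ∘ suc))

lookup-injective : {A : Set} {xs : List A} → Unique xs → Injective _≡_ _≡_ (lookup xs)
lookup-injective (_  ∷ _)  {zero}  {zero}  _  = refl
lookup-injective (x∉ ∷ _)  {zero}  {suc j} eq = contradiction eq (All.lookup x∉ (∈-lookup j))
lookup-injective (x∉ ∷ _)  {suc i} {zero}  eq = contradiction (sym eq) (All.lookup x∉ (∈-lookup i))
lookup-injective (_  ∷ us) {suc i} {suc j} eq = cong suc (lookup-injective us eq)

∣⁅x⁆∪p∣≤1+∣p∣ : ∀ {n} (x : Fin n) (p : Subset n) → ∣ ⁅ x ⁆ ∪ p ∣ ≤ suc ∣ p ∣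
∣⁅x⁆∪p∣≤1+∣p∣ zero    (b ∷ p) rewrite Subsetₚ.∪-identityˡ p = s≤s (Subsetₚ.∣p∣≤∣x∷p∣ b p)
∣⁅x⁆∪p∣≤1+∣p∣ (suc x) (inside  ∷ p) = s≤s (∣⁅x⁆∪p∣≤1+∣p∣ x p)
∣⁅x⁆∪p∣≤1+∣p∣ (suc x) (outside ∷ p) = ∣⁅x⁆∪p∣≤1+∣p∣ x p

Covered⇒∣p∣≤ : ∀ {n m} {p : Subset n} → Covered (_∈ₛ p) m → ∣ p ∣ ≤ m
Covered⇒∣p∣≤ {n} {p = p} (xs , xs≤ , xs∋) =
  ℕₚ.≤-trans (Subsetₚ.p⊆q⇒∣p∣≤∣q∣ (λ x∈p → ∈-support (xs∋ x∈p)))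
    (ℕₚ.≤-trans (∣support∣ xs) xs≤)
  where
  support : List (Fin n) → Subset n
  support []       = ∅
  support (x ∷ xs) = ⁅ x ⁆ ∪ support xs

  ∈-support : ∀ {x xs} → x ∈ xs → x ∈ₛ support xs
  ∈-support (here refl) = Subsetₚ.x∈p∪q⁺ (inj₁ (Subsetₚ.x∈⁅x⁆ _))
  ∈-support (there x∈)  = Subsetₚ.x∈p∪q⁺ (inj₂ (∈-support x∈))

  ∣support∣ : ∀ xs → ∣ support xs ∣ ≤ length xs
  ∣support∣ []       = ℕₚ.≤-reflexive (Subsetₚ.∣⊥∣≡0 n)
  ∣support∣ (x ∷ xs) = ℕₚ.≤-trans (∣⁅x⁆∪p∣≤1+∣p∣ x (support xs)) (s≤s (∣support∣ xs))

∈ₛ-Covered : ∀ {n} (p : Subset n) → Covered (_∈ₛ p) ∣ p ∣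
∈ₛ-Covered []            = [] , z≤n , λ ()
∈ₛ-Covered (inside  ∷ p) =
  let xs , xs≤ , xs∋ = ∈ₛ-Covered p
  in zero ∷ map suc xs , s≤s (subst (_≤ ∣ p ∣) (sym (Listₚ.length-map suc xs)) xs≤)
   , λ { Vec.here → here refl ; (Vec.there x∈) → there (∈-map⁺ suc (xs∋ x∈)) }
∈ₛ-Covered (outside ∷ p) =
  let xs , xs≤ , xs∋ = ∈ₛ-Covered p
  in map suc xs , subst (_≤ ∣ p ∣) (sym (Listₚ.length-map suc xs)) xs≤
   , λ { (Vec.there x∈) → ∈-map⁺ suc (xs∋ x∈) }

-- Every edge of an acyclic graph is a bridge.

module _ (T : Graph) (e : Edge T) where

  Avoiding : Vertex T → Vertex T → Set
  Avoiding x y = ∃[ e′ ] (e′ ≢ e × Joins T e′ x y)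

  record Path (k : ℕ) (y : Vertex T) : Set where
    field
      vertex           : Fin (suc k) → Vertex T
      edge             : Fin k → Edge T
      vertex-injective : Injective _≡_ _≡_ vertex
      joins            : ∀ i → Joins T (edge i) (vertex (inject₁ i)) (vertex (suc i))
      avoids           : ∀ i → edge i ≢ e
      end              : vertex (fromℕ k) ≡ y

  open Path

  drop : ∀ {k y} (p : Path k y) (i : Fin (suc k)) →
         ∃[ k′ ] Σ[ q ∈ Path k′ y ] vertex q zero ≡ vertex p i
  drop         p zero    = _ , p , refl
  drop {suc k} p (suc i) = drop tail i
    where
    tail : Path k _
    tail = record
      { vertex           = vertex p ∘ suc
      ; edge             = edge p ∘ suc
      ; vertex-injective = Finₚ.suc-injective ∘ vertex-injective p
      ; joins            = joins p ∘ suc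
      ; avoids           = avoids p ∘ suc
      ; end              = end p
      }

  -- Loop erasure: if the vertex to be prepended is already on the path, the path is cut back to
  -- begin there.
  toPath : ∀ {x y} → Star Avoiding x y → ∃[ k ] Σ[ p ∈ Path k y ] vertex p zero ≡ x
  toPath {x} ε = 0 , record
    { vertex           = λ _ → x
    ; edge             = λ ()
    ; vertex-injective = λ { {zero} {zero} _ → refl }
    ; joins            = λ ()
    ; avoids           = λ ()
    ; end              = refl
    } , refl
  toPath {x} {y} ((e′ , e′≢e , j) ◅ w) with toPath w
  ... | k , p , refl with Finₚ.any? (λ i → vertex p i Finₚ.≟ x)
  ...   | yes (i , eq) = let k′ , q , eq′ = drop p i in k′ , q , trans eq′ eq
  ...   | no  x∉p      = suc k , record
    { vertex           = v
    ; edge             = λ { zero → e′ ; (suc i) → edge p i }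
    ; vertex-injective = λ
        { {zero}  {zero}  _  → refl
        ; {zero}  {suc i} eq → contradiction (i , sym eq) x∉p
        ; {suc i} {zero}  eq → contradiction (i , eq) x∉p
        ; {suc i} {suc j} eq → cong suc (vertex-injective p eq)
        }
    ; joins            = λ { zero → j ; (suc i) → joins p i }
    ; avoids           = λ { zero → e′≢e ; (suc i) → avoids p i }
    ; end              = end p
    } , refl
    where
    v : Fin (suc (suc k)) → Vertex T
    v zero    = x
    v (suc i) = vertex p i

  close : ∀ {k x y} (p : Path k y) → vertex p zero ≡ x → Joins T e x y → Cycle T
  close {k} p refl j = record
    { k                = k
    ; vertex           = vertex p
    ; edge             = λ i → f (view i)
    ; vertex-injective = vertex-injective p
    ; edge-injective   = λ {i} {i′} → f-inj (view i) (view i′)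
    ; consecutive      = λ i → subst (λ e → Joins T e (vertex p (inject₁ i)) (vertex p (suc i)))
                           (sym (cong f (view-inject₁ i))) (joins p i)
    ; closing          = subst₂ (λ e y → Joins T e y (vertex p zero))
                           (sym (cong f (view-fromℕ k))) (sym (end p)) (Sum.swap j)
    }
    where
    f : ∀ {i : Fin (suc k)} → View i → Edge T
    f ‵fromℕ       = e
    f (‵inject₁ i) = edge p i

    edge-injective : ∀ i i′ → edge p i ≡ edge p i′ → i ≡ i′
    edge-injective i i′ eq with Joins-unique T (joins p i)
                                  (subst (λ e → Joins T e _ _) (sym eq) (joins p i′))
    ... | inj₁ (q , _) = Finₚ.inject₁-injective (vertex-injective p q)
    -- An edge traversed in both directions would give `i = i′ + 1` and `i′ = i + 1`.
    ... | inj₂ (q , r) = contradiction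
      (trans (sym (Finₚ.toℕ-inject₁ i)) (cong toℕ (vertex-injective p q)))
      λ i≡1+i′ → ℕₚ.m≢1+n+m (toℕ i) {1}
        (trans i≡1+i′ (cong suc (sym (trans (cong toℕ (vertex-injective p r))
                                            (Finₚ.toℕ-inject₁ i′)))))

    f-inj : ∀ {i i′ : Fin (suc k)} (ν : View i) (ν′ : View i′) → f ν ≡ f ν′ → i ≡ i′
    f-inj ‵fromℕ       ‵fromℕ        _  = refl
    f-inj ‵fromℕ       (‵inject₁ i′) eq = contradiction (sym eq) (avoids p i′)
    f-inj (‵inject₁ i) ‵fromℕ        eq = contradiction eq (avoids p i)
    f-inj (‵inject₁ i) (‵inject₁ i′) eq = cong inject₁ (edge-injective i i′ eq)

  bridge : ¬ Cycle T → ∀ {x y} → Joins T e x y → ¬ Star Avoiding x y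
  bridge acyclic j w = let _ , p , start = toPath w in acyclic (close p start j)

-- Rooting a tree by distance from a chosen node.

record Rooting (T : Graph) : Set where
  field
    root        : Vertex T
    parent      : Vertex T → Vertex T
    depth       : Vertex T → ℕ
    parent-root : parent root ≡ root
    descends    : ∀ x → x ≡ root ⊎ depth (parent x) < depth x
    adjacent    : ∀ {x y} → Adjacent T x y → x ≡ y ⊎ parent x ≡ y ⊎ parent y ≡ x

module _ (T : Graph) (isTree : IsTree T) where

  private
    root : Vertex T
    root = fromℕ< (IsTree.nonempty isTree)

  Reach : ℕ → Vertex T → Set
  Reach zero    x = x ≡ root
  Reach (suc n) x = Reach n x ⊎ (∃[ y ] (Reach n y × Adjacent T y x))

  reach? : ∀ n x → Dec (Reach n x)
  reach? zero    x = x Finₚ.≟ root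
  reach? (suc n) x = reach? n x ⊎-dec Finₚ.any? λ y → reach? n y ×-dec adjacent? T y x

  Reach-mono : ∀ {m n x} → m ≤ n → Reach m x → Reach n x
  Reach-mono {n = zero}  z≤n r = r
  Reach-mono {n = suc n} z≤n r = inj₁ (Reach-mono {n = n} z≤n r)
  Reach-mono (s≤s m≤n) (inj₁ r)           = inj₁ (Reach-mono m≤n r)
  Reach-mono (s≤s m≤n) (inj₂ (y , r , a)) = inj₂ (y , Reach-mono m≤n r , a)

  reachable : ∀ x → ∃[ n ] Reach n x
  reachable x = go refl (IsTree.connected isTree {root} {x} _ _)
    where
    go : ∀ {n u v} → Reach n u →
         Star (λ x y → U x × U y × Adjacent T x y) u v → ∃[ m ] Reach m v
    go {n} r ε = n , r
    go {n} r ((_ , _ , a) ◅ w) = go {suc n} (inj₂ (_ , r , a)) w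

  least : ∀ n {x} → Reach n x → ∃[ m ] (Reach m x × (∀ {k} → Reach k x → m ≤ k))
  least zero    r = 0 , r , λ _ → z≤n
  least (suc n) {x} r with reach? n x
  ... | yes r′ = least n r′
  ... | no ¬r′ = suc n , r , λ {k} rk → ℕₚ.≰⇒> λ k≤n → ¬r′ (Reach-mono k≤n rk)

  private
    nearest : ∀ x → ∃[ m ] (Reach m x × (∀ {k} → Reach k x → m ≤ k))
    nearest x = least (proj₁ (reachable x)) (proj₂ (reachable x))

    depth : Vertex T → ℕ
    depth x = proj₁ (nearest x)

    pred : ∀ x → ∃[ y ] ((x ≡ root × y ≡ root) ⊎ (depth y < depth x × Adjacent T x y))
    pred x with nearest x
    ... | zero  , x≡root , _ = root , inj₁ (x≡root , refl)
    ... | suc m , inj₁ r , minimal = contradiction (minimal r) (ℕₚ.n≮n m)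
    ... | suc m , inj₂ (y , r , a) , _ =
      y , inj₂ (s≤s (proj₂ (proj₂ (nearest y)) r) , Adjacent-sym T a)

    parent : Vertex T → Vertex T
    parent x = proj₁ (pred x)

    climb : ∀ (P : Vertex T → Vertex T → Set) → (∀ x → Adjacent T x (parent x) → P x (parent x)) →
            ∀ n x → depth x ≤ n → Star P x root
    climb P step n x d≤n with pred x | step x
    ... | y , inj₁ (refl , _) | _ = ε
    climb P step (suc n) x d≤n | y , inj₂ (d< , a) | s =
      s a ◅ climb P step n y (ℕₚ.≤-pred (ℕₚ.≤-trans d< d≤n))
    climb P step zero x d≤n | y , inj₂ (d< , a) | s = contradiction (ℕₚ.≤-trans d< d≤n) λ ()

    climbing : ∀ {x y} (j : Adjacent T x y) → parent x ≢ y → parent y ≢ x →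
               ∀ z → Star (Avoiding T (proj₁ j)) z root
    climbing (e , j) px≢y py≢x z = climb (Avoiding T e)
      (λ { z (e′ , j′) → e′ , (λ { refl → case Joins-unique T j′ j of λ
           { (inj₁ (refl , eq)) → px≢y eq
           ; (inj₂ (refl , eq)) → py≢x eq } }) , j′ })
      (depth z) z ℕₚ.≤-refl

    -- If neither end were the parent of the other, no step from a node to its parent could use the
    -- edge. The climbs from `x` and `y` to the root would then connect its ends without it,
    -- although it is a bridge.
    tree-adjacent : ∀ {x y} → Adjacent T x y → x ≡ y ⊎ parent x ≡ y ⊎ parent y ≡ x
    tree-adjacent {x} {y} a@(e , j) with parent x Finₚ.≟ y | parent y Finₚ.≟ x
    ... | yes p | _     = inj₂ (inj₁ p)
    ... | no _  | yes q = inj₂ (inj₂ q)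
    ... | no p  | no q  = contradiction
      (climbing a p q x ◅◅
        reverse (λ { (e′ , e′≢e , j′) → e′ , e′≢e , Sum.swap j′ }) (climbing a p q y))
      (bridge T e (IsTree.acyclic isTree) j)

  rooting : Rooting T
  rooting = record
    { root        = root
    ; parent      = parent
    ; depth       = depth
    ; parent-root = case proj₂ (pred root) of λ
        { (inj₁ (_ , eq)) → eq
        ; (inj₂ (d< , _)) → contradiction
            (ℕₚ.≤-trans d< (proj₂ (proj₂ (nearest root)) {0} refl)) λ () }
    ; descends    = λ x → Sum.map proj₁ proj₁ (proj₂ (pred x))
    ; adjacent    = tree-adjacent
    }

-- Ancestors, lowest common ancestors, and the pieces they cut a tree into.

module Ancestors {T : Graph} (R : Rooting T) where

  open Rooting R

  data _≼_ (x : Vertex T) : Vertex T → Set where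
    here : x ≼ x
    up   : ∀ {y} → x ≼ parent y → x ≼ y

  depth-parent : ∀ y → depth (parent y) ≤ depth y
  depth-parent y with descends y
  ... | inj₁ refl = ℕₚ.≤-reflexive (cong depth parent-root)
  ... | inj₂ d<   = ℕₚ.<⇒≤ d<

  -- The root is its own parent, so an `up` step may stand still; comparing depths separates the two
  -- cases and yields antisymmetry.
  ≼⇒≡⊎< : ∀ {x y} → x ≼ y → x ≡ y ⊎ depth x < depth y
  ≼⇒≡⊎< here = inj₁ refl
  ≼⇒≡⊎< {x} {y} (up x≼) with ≼⇒≡⊎< x≼ | descends y
  ... | inj₂ d<   | _         = inj₂ (ℕₚ.≤-trans d< (depth-parent y))
  ... | inj₁ refl | inj₁ refl = inj₁ parent-root
  ... | inj₁ refl | inj₂ d<   = inj₂ d<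

  ≼-antisym : ∀ {x y} → x ≼ y → y ≼ x → x ≡ y
  ≼-antisym p q with ≼⇒≡⊎< p | ≼⇒≡⊎< q
  ... | inj₁ eq | _       = eq
  ... | inj₂ _  | inj₁ eq = sym eq
  ... | inj₂ d< | inj₂ d> = contradiction d> (ℕₚ.<-asym d<)

  ≼-trans : ∀ {x y z} → x ≼ y → y ≼ z → x ≼ z
  ≼-trans p here   = p
  ≼-trans p (up q) = up (≼-trans p q)

  ≼-total : ∀ {x y z} → x ≼ z → y ≼ z → x ≼ y ⊎ y ≼ x
  ≼-total here   q      = inj₂ q
  ≼-total p      here   = inj₁ p
  ≼-total (up p) (up q) = ≼-total p q

  ≼-root : ∀ {x} → x ≼ root → x ≡ root
  ≼-root p with ≼⇒≡⊎< p
  ... | inj₁ eq = eq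
  ... | inj₂ d< = go p refl
    where
    go : ∀ {x y} → x ≼ y → y ≡ root → x ≡ root
    go here   eq   = eq
    go (up p) refl = go p parent-root

  opaque
    depth-induction : (P : Vertex T → Set) → P root → (∀ x → P (parent x) → P x) → ∀ x → P x
    depth-induction P base step x = go (depth x) x ℕₚ.≤-refl
      where
      go : ∀ n x → depth x ≤ n → P x
      go n x d≤n with descends x
      go n       x d≤n | inj₁ refl = base
      go zero    x d≤n | inj₂ d<   = contradiction (ℕₚ.≤-trans d< d≤n) λ ()
      go (suc n) x d≤n | inj₂ d<   = step x (go n (parent x) (ℕₚ.≤-pred (ℕₚ.≤-trans d< d≤n)))

  root≼ : ∀ x → root ≼ x
  root≼ = depth-induction (root ≼_) here λ _ → up

  _≼?_ : ∀ x y → Dec (x ≼ y)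
  x ≼? y = depth-induction (λ y → Dec (x ≼ y))
    (map′ (λ { refl → here }) ≼-root (x Finₚ.≟ root)) step y
    where
    step : ∀ y → Dec (x ≼ parent y) → Dec (x ≼ y)
    step y (yes p) = yes (up p)
    step y (no ¬p) = map′ (λ { refl → here })
      (λ { here → refl ; (up p) → contradiction p ¬p }) (x Finₚ.≟ y)

  record LCA (x y : Vertex T) : Set where
    field
      node     : Vertex T
      left     : node ≼ x
      right    : node ≼ y
      greatest : ∀ {z} → z ≼ x → z ≼ y → z ≼ node

  opaque
    lca : ∀ x y → LCA x y
    lca x y = depth-induction (λ x → LCA x y)
      (record { node = root ; left = here ; right = root≼ y ; greatest = λ p _ → p }) step x
      where
      step : ∀ x → LCA (parent x) y → LCA x y
      step x l with x ≼? y
      ... | yes p = record { node = x ; left = here ; right = p ; greatest = λ q _ → q }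
      ... | no ¬p = record
        { node     = LCA.node l
        ; left     = up (LCA.left l)
        ; right    = LCA.right l
        ; greatest = λ { here q → contradiction q ¬p ; (up r) q → LCA.greatest l r q }
        }

  module Closure (N : List (Vertex T)) where

    -- One round of pairwise lowest common ancestors is what `Hangs-unique` rests on; the pairs on
    -- the diagonal contribute `N` itself.
    closure : List (Vertex T)
    closure = cartesianProductWith (λ x y → LCA.node (lca x y)) N N

    length-closure : length closure ≡ length N * length N
    length-closure = length-cartesianProductWith _ N N

    lca∈closure : ∀ {x y} → x ∈ N → y ∈ N → LCA.node (lca x y) ∈ closure
    lca∈closure = ∈-cartesianProductWith⁺ (λ x y → LCA.node (lca x y))

    N⊆closure : ∀ {x} → x ∈ N → x ∈ closure
    N⊆closure {x} x∈N = subst (_∈ closure)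
      (≼-antisym (LCA.left l) (LCA.greatest l here here)) (lca∈closure x∈N x∈N)
      where l = lca x x

    below : ∀ {y} → y ∈ closure → ∃[ x ] (x ∈ N × y ≼ x)
    below y∈ with x , y , x∈N , _ , refl ← ∈-cartesianProductWith⁻ _ N N y∈ =
      x , x∈N , LCA.left (lca x y)

    open DecMembership (Finₚ._≟_ {#V T}) using (_∈?_)

    data Clear (t : Vertex T) : Vertex T → Set where
      stop : t ∉ closure → Clear t t
      up   : ∀ {y} → y ∉ closure → Clear t (parent y) → Clear t y

    Clear⇒∉ : ∀ {t y} → Clear t y → y ∉ closure
    Clear⇒∉ (stop y∉) = y∉
    Clear⇒∉ (up y∉ _) = y∉

    Clear⇒≼ : ∀ {t y} → Clear t y → t ≼ y
    Clear⇒≼ (stop _)  = here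
    Clear⇒≼ (up _ cl) = up (Clear⇒≼ cl)

    Clear-between : ∀ {t x y} → Clear t y → t ≼ x → x ≼ y → x ∉ closure
    Clear-between (stop t∉) t≼x x≼t = subst (_∉ closure) (≼-antisym t≼x x≼t) t∉
    Clear-between (up y∉ _) t≼x here = y∉
    Clear-between (up _ cl) t≼x (up x≼) = Clear-between cl t≼x x≼

    -- For `t` outside the closure: `t` is the highest node of its component in the tree minus
    -- `closure`.
    Top : Vertex T → Set
    Top t = t ≡ root ⊎ parent t ∈ closure

    opaque
      topOf : ∀ y → ∃[ t ] (y ∉ closure → Clear t y × Top t)
      topOf = depth-induction _ (root , λ r∉ → stop r∉ , inj₁ refl) step
        where
        step : ∀ y → ∃[ t ] (parent y ∉ closure → Clear t (parent y) × Top t) →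
               ∃[ t ] (y ∉ closure → Clear t y × Top t)
        step y (t , p) with parent y ∈? closure
        ... | yes py∈ = y , λ y∉ → stop y∉ , inj₂ py∈
        ... | no  py∉ = t , λ y∉ → up y∉ (proj₁ (p py∉)) , proj₂ (p py∉)

    top : Vertex T → Vertex T
    top y = proj₁ (topOf y)

    Clear-root : ∀ {t} → Clear t root → t ≡ root
    Clear-root cl = ≼-root (Clear⇒≼ cl)

    top-unique : ∀ {t t′ y} → Top t → Top t′ → Clear t y → Clear t′ y → t ≡ t′
    top-unique T₁ T₂ (stop _)  (stop _)  = refl
    top-unique T₁ T₂ (up _ c)  (up _ c′) = top-unique T₁ T₂ c c′
    top-unique (inj₁ refl) T₂ (stop _) c′@(up _ _) = sym (Clear-root c′)
    top-unique (inj₂ p∈)   T₂ (stop _) (up _ c′) = contradiction p∈ (Clear⇒∉ c′)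
    top-unique T₁ (inj₁ refl) c@(up _ _) (stop _)  = Clear-root c
    top-unique T₁ (inj₂ p∈)   (up _ c) (stop _)  = contradiction p∈ (Clear⇒∉ c)

    top-parent : ∀ {y} → y ∉ closure → parent y ∉ closure → top y ≡ top (parent y)
    top-parent {y} y∉ py∉ =
      let c  , T₁ = proj₂ (topOf y) y∉
          c′ , T₂ = proj₂ (topOf (parent y)) py∉
      in top-unique T₁ T₂ c (up y∉ c′)

    -- Tree edges run between parent and child, so `top-parent` suffices. Hence `top` names the
    -- components of the tree minus `closure`.
    top-adjacent : ∀ {x y} → x ∉ closure → y ∉ closure → Adjacent T x y → top x ≡ top y
    top-adjacent x∉ y∉ a with adjacent a
    ... | inj₁ refl        = refl
    ... | inj₂ (inj₁ refl) = top-parent x∉ y∉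
    ... | inj₂ (inj₂ refl) = sym (top-parent y∉ x∉)

    Clear-stop : ∀ {t y} → parent y ∈ closure → Clear t y → t ≡ y
    Clear-stop py∈ (stop _) = refl
    Clear-stop py∈ (up _ c) = contradiction py∈ (Clear⇒∉ c)

    top≡self : ∀ {y} → y ∉ closure → parent y ∈ closure → top y ≡ y
    top≡self {y} y∉ py∈ = Clear-stop py∈ (proj₁ (proj₂ (topOf y) y∉))

    Hangs : Vertex T → Vertex T → Set
    Hangs t b = parent b ∉ closure × top (parent b) ≡ t

    -- Otherwise the lowest common ancestor of two elements of N below b and b′ would lie
    -- strictly inside the piece, although the closure contains it.
    Hangs-unique : ∀ {t b b′} → b ∈ closure → b′ ∈ closure → Hangs t b → Hangs t b′ → b ≡ b′
    Hangs-unique {t} {b} {b′} b∈ b′∈ (pb∉ , refl) (pb′∉ , eq′)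
      with x , x∈N , b≼x ← below b∈ | x′ , x′∈N , b′≼x′ ← below b′∈
      = ordered (≼-total b≼m′ b′≼m′)
      where
      l = lca x x′
      m = LCA.node l

      c : Clear t (parent b)
      c = proj₁ (proj₂ (topOf (parent b)) pb∉)

      c′ : Clear t (parent b′)
      c′ = subst (λ t → Clear t (parent b′)) eq′ (proj₁ (proj₂ (topOf (parent b′)) pb′∉))

      t≼b : t ≼ b
      t≼b = up (Clear⇒≼ c)

      t≼b′ : t ≼ b′
      t≼b′ = up (Clear⇒≼ c′)

      t≼m : t ≼ m
      t≼m = LCA.greatest l (≼-trans t≼b b≼x) (≼-trans t≼b′ b′≼x′)

      above : ∀ {b z} → Clear t (parent b) → m ≼ z → b ≼ z → b ≼ m
      above cb m≼z b≼z with ≼-total b≼z m≼z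
      ... | inj₁ b≼m      = b≼m
      ... | inj₂ here     = here
      ... | inj₂ (up m≼p) = contradiction (lca∈closure x∈N x′∈N) (Clear-between cb t≼m m≼p)

      b≼m′ : b ≼ m
      b≼m′ = above c (LCA.left l) b≼x

      b′≼m′ : b′ ≼ m
      b′≼m′ = above c′ (LCA.right l) b′≼x′

      -- Both lie above `m`, hence are comparable, and the higher one would interrupt the clear way
      -- from `t` to the parent of the lower one.
      ordered : b ≼ b′ ⊎ b′ ≼ b → b ≡ b′
      ordered (inj₁ here)     = refl
      ordered (inj₁ (up b≼p)) = contradiction b∈ (Clear-between c′ t≼b b≼p)
      ordered (inj₂ here)     = refl
      ordered (inj₂ (up b≼p)) = contradiction b′∈ (Clear-between c t≼b′ b≼p)

-- Separators from tree decompositions.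

record Separation (G : Graph) (Y : List (Vertex G)) (n m : ℕ) : Set where
  field
    separator     : List (Vertex G)
    Y⊆separator   : ∀ {y} → y ∈ Y → y ∈ separator
    size          : length separator ≤ n
    -- The number of parts is unbounded, and `part` carries no information on the separator.
    #parts        : ℕ
    part          : Vertex G → Fin #parts
    part-adjacent : ∀ {u v} → u ∉ separator → v ∉ separator → Adjacent G u v → part u ≡ part v
    boundary      : ∀ p → Covered (λ u → u ∈ separator ×
                      ∃[ v ] (v ∉ separator × part v ≡ p × Adjacent G v u)) m

module _ (G : Graph) {w : ℕ} (D : TreeDecomposition G)
         (width≤w : TreeDecomposition.width D ≤ w) where

  open TreeDecomposition D

  ∣bag∣≤ : ∀ x → ∣ bag x ∣ ≤ suc w
  ∣bag∣≤ x = ℕₚ.≤-trans (≤-foldr _ x)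
    (ℕₚ.≤-trans (ℕₚ.m≤n+m∸n _ 1) (s≤s width≤w))
    where
    ≤-foldr : ∀ {n} (f : Fin n → ℕ) i → f i ≤ Vector.foldr _⊔_ 0 f
    ≤-foldr f zero    = ℕₚ.m≤m⊔n _ _
    ≤-foldr f (suc i) = ℕₚ.≤-trans (≤-foldr (f ∘ suc) i) (ℕₚ.m≤n⊔m (f zero) _)

  bag-Covered : ∀ x → Covered (_∈ₛ bag x) (suc w)
  bag-Covered x = let xs , xs≤ , xs∋ = ∈ₛ-Covered (bag x) in
    xs , ℕₚ.≤-trans xs≤ (∣bag∣≤ x) , xs∋

  -- The bags at the at most `n * n` nodes of the closure form the separator. A part belongs to a
  -- component of the rest of the tree, which borders on the closure in at most two nodes: the
  -- parent of its top and, by `Hangs-unique`, one node below. Their bags contain the boundary of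
  -- the part.
  separate : ∀ {n} Y → length Y ≤ n → Separation G Y (n * n * suc w) (suc w + suc w)
  separate {n} Y Y≤n = record
    { separator     = X
    ; Y⊆separator   = λ y∈ → ∈X (N⊆closure (∈-map⁺ home y∈)) (∈home _)
    ; size          = ℕₚ.≤-trans (Listₚ.length-filter inBags? (proj₁ X-Covered))
                        (ℕₚ.≤-trans (proj₁ (proj₂ X-Covered)) (ℕₚ.*-monoˡ-≤ (suc w) closure≤))
    ; #parts        = #V tree
    ; part          = λ v → top (home v)
    ; part-adjacent = part-adjacent
    ; boundary      = boundary
    }
    where
    R = rooting tree isTree
    open Rooting R
    open Ancestors R

    home : Vertex G → Vertex tree
    home v = proj₁ (covers-vertex v)

    ∈home : ∀ v → v ∈ₛ bag (home v)
    ∈home v = proj₂ (covers-vertex v)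

    open Closure (map home Y)
    open DecMembership (Finₚ._≟_ {#V tree}) using (_∈?_)

    closure≤ : length closure ≤ n * n
    closure≤ = subst (_≤ n * n)
      (sym (trans length-closure (cong₂ _*_ (Listₚ.length-map home Y) (Listₚ.length-map home Y))))
      (ℕₚ.*-mono-≤ Y≤n Y≤n)

    X-Covered = Covered-⋃ {P = λ x → _∈ₛ bag x} closure bag-Covered

    inBags? : ∀ v → Dec (∃[ x ] (x ∈ closure × v ∈ₛ bag x))
    inBags? v = Finₚ.any? λ x → (x ∈? closure) ×-dec (v Subsetₚ.∈? bag x)

    -- A covering list may contain too much; after filtering, membership in `X` means lying in one
    -- of these bags.
    X : List (Vertex G)
    X = filter inBags? (proj₁ X-Covered)

    ∈X : ∀ {x v} → x ∈ closure → v ∈ₛ bag x → v ∈ X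
    ∈X x∈ v∈ = ∈-filter⁺ inBags? (proj₂ (proj₂ X-Covered) (_ , x∈ , v∈)) (_ , x∈ , v∈)

    X∋ : ∀ {v} → v ∈ X → ∃[ x ] (x ∈ closure × v ∈ₛ bag x)
    X∋ v∈ = proj₂ (∈-filter⁻ inBags? {xs = proj₁ X-Covered} v∈)

    adjacent-bag : ∀ {u v} → Adjacent G u v → ∃[ x ] (u ∈ₛ bag x × v ∈ₛ bag x)
    adjacent-bag (e , inj₁ eq) = let x , p , q = covers-edge e in
      x , subst (_∈ₛ bag x) (cong proj₁ eq) p , subst (_∈ₛ bag x) (cong proj₂ eq) q
    adjacent-bag (e , inj₂ eq) = let x , p , q = covers-edge e in
      x , subst (_∈ₛ bag x) (cong proj₂ eq) q , subst (_∈ₛ bag x) (cong proj₁ eq) p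

    -- No bag at a node of the closure contains `v`, so the walk through bags containing `v` stays
    -- in one component.
    top-constant : ∀ {v x y} → v ∉ X →
      Star (λ x y → v ∈ₛ bag x × v ∈ₛ bag y × Adjacent tree x y) x y → top x ≡ top y
    top-constant v∉ ε = refl
    top-constant v∉ ((p , q , a) ◅ s) = trans
      (top-adjacent (λ x∈ → v∉ (∈X x∈ p)) (λ y∈ → v∉ (∈X y∈ q)) a) (top-constant v∉ s)

    top-home : ∀ {v x} → v ∉ X → v ∈ₛ bag x → top (home v) ≡ top x
    top-home v∉ v∈ = top-constant v∉ (coherent _ (∈home _) v∈)

    part-adjacent : ∀ {u v} → u ∉ X → v ∉ X → Adjacent G u v → top (home u) ≡ top (home v)
    part-adjacent u∉ v∉ a = let x , u∈ , v∈ = adjacent-bag a in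
      trans (top-home u∉ u∈) (sym (top-home v∉ v∈))

    Lower : Vertex tree → Vertex G → Set
    Lower t u = ∃[ b ] (b ∈ closure × Hangs t b × u ∈ₛ bag b)

    -- The first step of the walk into the closure goes either up, to the parent of the top, or
    -- down, to a node hanging from the component; every bag along the walk contains `u`.
    entry : ∀ {u x y} → x ∉ closure → y ∈ closure →
      Star (λ x y → u ∈ₛ bag x × u ∈ₛ bag y × Adjacent tree x y) x y →
      u ∈ₛ bag (parent (top x)) ⊎ Lower (top x) u
    entry x∉ y∈ ε = contradiction y∈ x∉
    entry {u} x∉ y∈ (_◅_ {j = z} (p , q , a) s) with z ∈? closure
    ... | no  z∉ = subst (λ t → u ∈ₛ bag (parent t) ⊎ Lower t u)
                     (sym (top-adjacent x∉ z∉ a)) (entry z∉ y∈ s)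
    ... | yes z∈ with adjacent a
    ...   | inj₁ refl        = contradiction z∈ x∉
    ...   | inj₂ (inj₁ refl) = inj₁ (subst (λ t → u ∈ₛ bag (parent t)) (sym (top≡self x∉ z∈)) q)
    ...   | inj₂ (inj₂ refl) = inj₂ (z , z∈ , (x∉ , refl) , q)

    hangs? : ∀ t b → Dec (Hangs t b)
    hangs? t b = ¬? (parent b ∈? closure) ×-dec (top (parent b) Finₚ.≟ t)

    lower-Covered : ∀ t → Covered (Lower t) (suc w)
    lower-Covered t with Any.any? (hangs? t) closure
    ... | no ¬h = [] , z≤n , λ { (b , b∈ , h , _) → contradiction (lose b∈ h) ¬h }
    ... | yes h =
      let b , b∈ , hb = find h
          xs , xs≤ , xs∋ = bag-Covered b
      in xs , xs≤ , λ { (b′ , b′∈ , hb′ , u∈) →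
           xs∋ (subst (λ b → _ ∈ₛ bag b) (Hangs-unique b′∈ b∈ hb′ hb) u∈) }

    boundary : ∀ t → Covered (λ u → u ∈ X × ∃[ v ] (v ∉ X × top (home v) ≡ t × Adjacent G v u))
                             (suc w + suc w)
    boundary t =
      let xs , xs≤ , xs∋ = bag-Covered (parent t)
          ys , ys≤ , ys∋ = lower-Covered t
      in xs ++ ys , subst (_≤ _) (sym (Listₚ.length-++ xs)) (ℕₚ.+-mono-≤ xs≤ ys≤)
       , λ {u} → λ { (u∈ , v , v∉ , refl , a) →
           let x , v∈x , u∈x = adjacent-bag a
               y , y∈ , u∈y  = X∋ u∈
           in [ ∈-++⁺ˡ ∘ xs∋ , ∈-++⁺ʳ xs ∘ ys∋ ]′
                (subst (λ t → u ∈ₛ bag (parent t) ⊎ Lower t u) (sym (top-home v∉ v∈x))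
                  (entry (λ x∈ → v∉ (∈X x∈ v∈x)) y∈ (coherent u u∈x u∈y))) }

-- Rich vertices and the colouring in rounds.

-- Choose the colour that need not be seen and a neighbour in each of the s other colours; these
-- s neighbours have fewer than t common neighbours.
richBound : ℕ → ℕ → ℕ → ℕ
richBound s t n = suc s * n ^ s * t

richBound-mono : ∀ s t {m n} → m ≤ n → richBound s t m ≤ richBound s t n
richBound-mono s t m≤n = ℕₚ.*-monoˡ-≤ t (ℕₚ.*-monoʳ-≤ (suc s) (ℕₚ.^-monoˡ-≤ s m≤n))

-- Bounds the set coloured in `k` rounds next to a boundary of size `m`: a round adds only vertices
-- rich to the at most `n + m` coloured ones.
roundsBound : ℕ → ℕ → ℕ → ℕ → ℕ
roundsBound s t m zero    = 0
roundsBound s t m (suc k) = let n = roundsBound s t m k in richBound s t (n + m) + n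

-- The separator, of size `x`, and the sets `W` of the parts, at most `richBound s t x` of which are
-- nonempty.
islandBound : ℕ → ℕ → ℕ → ℕ → ℕ
islandBound s t m x = x + richBound s t x * roundsBound s t m (suc s)

module Colours (G : Graph) (s : ℕ) where

  V = Vertex G
  Colour = Fin (suc s)

  open DecMembership (Finₚ._≟_ {#V G}) using (_∈?_)

  Sees : Coloring G (suc s) → List V → V → Colour → Set
  Sees c Y v i = ∃[ u ] (u ∈ Y × Adjacent G v u × c u ≡ i)

  opaque
    sees? : ∀ c Y v i → Dec (Sees c Y v i)
    sees? c Y v i = Finₚ.any? λ u → (u ∈? Y) ×-dec adjacent? G v u ×-dec (c u Finₚ.≟ i)

  Rich : Coloring G (suc s) → List V → V → Set
  Rich c Y v = ∃[ i ] (∀ j → j ≢ i → Sees c Y v j)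

  opaque
    rich? : ∀ c Y v → Dec (Rich c Y v)
    rich? c Y v = Finₚ.any? λ i → Finₚ.all? λ j → ¬? (j Finₚ.≟ i) →-dec sees? c Y v j

  Free : Coloring G (suc s) → List V → V → Set
  Free c Y v = ∃[ i ] ¬ Sees c Y v i

  Sees-mono : ∀ {c c′ Y Y′ v i} → (∀ {u} → u ∈ Y → u ∈ Y′ × c u ≡ c′ u) →
              Sees c Y v i → Sees c′ Y′ v i
  Sees-mono f (u , u∈ , a , eq) = u , proj₁ (f u∈) , a , trans (sym (proj₂ (f u∈))) eq

  Rich-mono : ∀ {c c′ Y Y′ v} → (∀ {u} → u ∈ Y → u ∈ Y′ × c u ≡ c′ u) →
              Rich c Y v → Rich c′ Y′ v
  Rich-mono f (i , r) = i , λ j j≢i → Sees-mono f (r j j≢i)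

  -- A poor vertex misses two colours, so one is left when a round gives out the colour `i`.
  poor⇒free : ∀ {c Y v} → ¬ Rich c Y v → ∀ i → ∃[ j ] (j ≢ i × ¬ Sees c Y v j)
  poor⇒free {c} {Y} {v} ¬r i =
    let j , ¬f = Finₚ.¬∀⟶∃¬ (suc s) (λ j → j ≢ i → Sees c Y v j)
                   (λ j → ¬? (j Finₚ.≟ i) →-dec sees? c Y v j) λ f → ¬r (i , f)
    in j , (λ j≡i → ¬f λ j≢i → contradiction j≡i j≢i) , λ sees → ¬f λ _ → sees

  -- `c₀` is total, but its values on `Z` are placeholders. In the recursion, `O` is the portion of
  -- `B` that was coloured before the separator was filled up.
  record Piece (Z : V → Set) (c₀ : Coloring G (suc s)) (B O : List V) : Set where
    field
      Z?       : Decidable Z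
      boundary : ∀ {z u} → Z z → Adjacent G z u → Z u ⊎ u ∈ B
      disjoint : ∀ {u} → u ∈ B → ¬ Z u
      O⊆B      : ∀ {u} → u ∈ O → u ∈ B
      free     : ∀ {z} → Z z → Free c₀ O z

  module _ {t : ℕ} (1≤t : 1 ≤ t) (K⋢G : ¬ K s t ⊑ G) where

    -- `us` holds one vertex for each colour other than `i`. A loop could make `v` its own
    -- neighbour; `v ≢ u` keeps the two sides of the bipartite graph disjoint.
    Common : Coloring G (suc s) → Colour × Vec V s → V → Set
    Common c (i , us) v = ∀ j → let u = Vec.lookup us j in
      v ≢ u × Adjacent G v u × c u ≡ punchIn i j

    common? : ∀ c p v → Dec (Common c p v)
    common? c (i , us) v = Finₚ.all? λ j → let u = Vec.lookup us j in
      ¬? (v Finₚ.≟ u) ×-dec adjacent? G v u ×-dec (c u Finₚ.≟ punchIn i j)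

    -- The entries of `us` differ in colour, hence are distinct, and together with `t` common
    -- neighbours they form `K s t`.
    Common-Covered : ∀ c p → Covered (Common c p) t
    Common-Covered c p@(i , us) = vs , ℕₚ.≮⇒≥ many , λ cm →
        ∈-filter⁺ (common? c p) (∈-allFin _) cm
      where
      vs = filter (common? c p) (allFin (#V G))

      common : ∀ j → Common c p (lookup vs j)
      common j = proj₂ (∈-filter⁻ (common? c p) {xs = allFin _} (∈-lookup j))

      many : ¬ t < length vs
      many t< = K⋢G (K⊑ G (Vec.lookup us) (λ j → lookup vs (inject≤ j t≤))
        (λ {j} {k} eq → Finₚ.punchIn-injective i j k
          (trans (sym (colour j)) (trans (cong c eq) (colour k))))
        (λ eq → Finₚ.inject≤-injective t≤ t≤ _ _
          (lookup-injective (Uniqueₚ.filter⁺ (common? c p) (Uniqueₚ.allFin⁺ _)) eq))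
        (λ i j eq → proj₁ (common (inject≤ j t≤) i) (sym eq))
        (λ i j → Adjacent-sym G (proj₁ (proj₂ (common (inject≤ j t≤) i)))))
        where
        t≤ = ℕₚ.<⇒≤ t<

        -- The colours of `us` are known only through a common neighbour; `1 ≤ t` helps to supply
        -- one.
        colour : ∀ j → c (Vec.lookup us j) ≡ punchIn i j
        colour j = proj₂ (proj₂ (common (fromℕ< (ℕₚ.≤-trans 1≤t t≤)) j))

    opaque
      Rich-Covered : ∀ c Y → Covered (λ v → v ∉ Y × Rich c Y v) (richBound s t (length Y))
      Rich-Covered c Y =
        let xs , xs≤ , xs∋ = Covered-⋃ {P = Common c} patterns (Common-Covered c)
        in xs , subst (λ n → length xs ≤ n * t) length-patterns xs≤
         , λ { {v} (v∉Y , i , r) →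
             let f : ∀ j → Sees c Y v (punchIn i j)
                 f j = r (punchIn i j) (Finₚ.punchInᵢ≢i i j)
             in xs∋ ((i , Vec.tabulate (proj₁ ∘ f))
                  , ∈-cartesianProduct⁺ (∈-allFin i) (∈-tuples (proj₁ ∘ f) (proj₁ ∘ proj₂ ∘ f))
                  , λ j → subst (λ u → v ≢ u × Adjacent G v u × c u ≡ punchIn i j)
                      (sym (Vecₚ.lookup∘tabulate (proj₁ ∘ f) j))
                      ((λ eq → v∉Y (subst (_∈ Y) (sym eq) (proj₁ (proj₂ (f j)))))
                      , proj₂ (proj₂ (f j)))) }
        where
        patterns : List (Colour × Vec V s)
        patterns = cartesianProduct (allFin (suc s)) (tuples s Y)

        length-patterns : length patterns ≡ suc s * length Y ^ s
        length-patterns = trans (length-cartesianProductWith _,_ (allFin (suc s)) (tuples s Y))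
          (cong₂ _*_ (Listₚ.length-tabulate {n = suc s} id) (length-tuples s Y))

    -- The state after the rounds of the colours in `done`. Once all colours are done, `rich`
    -- contradicts the field `free` of `Piece`, so no vertex of `Z` rich to `B` is left outside `W`.
    -- `source` will bound the number of parts with nonempty `W`.
    record Partial {Z c₀ B O} (piece : Piece Z c₀ B O) (done : List Colour) (n : ℕ) : Set where
      field
        col       : Coloring G (suc s)
        W         : List V
        W⊆Z       : ∀ {w} → w ∈ W → Z w
        size      : length W ≤ n
        unchanged : ∀ {v} → v ∉ W → col v ≡ c₀ v
        avoids    : ∀ {w o} → w ∈ W → o ∈ O → Adjacent G w o → col w ≢ c₀ o
        rich      : ∀ {z i} → Z z → z ∉ W → Rich c₀ B z → i ∈ done → Sees c₀ O z i
        free      : ∀ {z} → Z z → z ∉ W → ¬ Rich c₀ B z → Free col (W ++ B) z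
        source    : ∀ {w} → w ∈ W → ∃[ r ] (Z r × Rich c₀ B r)

    module _ {Z c₀ B O m} (piece : Piece Z c₀ B O) (B≤m : length B ≤ m) where

      open Piece piece

      start : Partial piece [] 0
      start = record
        { col       = c₀
        ; W         = []
        ; W⊆Z       = λ ()
        ; size      = z≤n
        ; unchanged = λ _ → refl
        ; avoids    = λ ()
        ; rich      = λ _ _ _ ()
        ; free      = λ _ _ ¬r → let j , _ , ¬sees = poor⇒free ¬r zero in j , ¬sees
        ; source    = λ ()
        }

      -- Giving out a single colour per round costs a poor vertex at most one of its two missing
      -- colours, and turns avoidance of `O` into a condition on `i` alone.
      round : ∀ i {done n} → Partial piece done n →
              Partial piece (i ∷ done) (richBound s t (n + m) + n)
      round i {done} {n} P = record
        { col       = col′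
        ; W         = N ++ W
        ; W⊆Z       = [ (λ w∈ → proj₁ (N∋ w∈)) , W⊆Z ]′ ∘ ∈-++⁻ N
        ; size      = subst (_≤ richBound s t (n + m) + n) (sym (Listₚ.length-++ N))
                        (ℕₚ.+-mono-≤ size-N size)
        ; unchanged = λ v∉ → trans (col′-∉ (v∉ ∘ ∈-++⁺ˡ)) (unchanged (v∉ ∘ ∈-++⁺ʳ N))
        ; avoids    = λ {w} {o} w∈ o∈ a → [ avoids-N o∈ a , avoids-W o∈ a ]′ (∈-++⁻ N w∈)
        ; rich      = rich′
        ; free      = free′
        ; source    = [ (λ w∈ → source-Rich (N∋ w∈)) , source ]′ ∘ ∈-++⁻ N
        }
        where
        open Partial P renaming (free to free-Partial)

        Y : List V
        Y = W ++ B

        New : V → Set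
        New v = Z v × v ∉ W × ¬ Sees c₀ O v i × Rich col Y v

        new? : Decidable New
        new? v = Z? v ×-dec ¬? (v ∈? W) ×-dec ¬? (sees? c₀ O v i) ×-dec rich? col Y v

        richList = Rich-Covered col Y

        N : List V
        N = filter new? (proj₁ richList)

        N∋ : ∀ {v} → v ∈ N → New v
        N∋ v∈ = proj₂ (∈-filter⁻ new? {xs = proj₁ richList} v∈)

        ∉Y : ∀ {v} → Z v → v ∉ W → v ∉ Y
        ∉Y zv v∉W = [ v∉W , (λ v∈B → disjoint v∈B zv) ]′ ∘ ∈-++⁻ W

        ∈N : ∀ {v} → New v → v ∈ N
        ∈N new@(zv , v∉W , _ , r) =
          ∈-filter⁺ new? (proj₂ (proj₂ richList) (∉Y zv v∉W , r)) new

        size-N : length N ≤ richBound s t (n + m)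
        size-N = ℕₚ.≤-trans (Listₚ.length-filter new? (proj₁ richList))
          (ℕₚ.≤-trans (proj₁ (proj₂ richList)) (richBound-mono s t
            (subst (_≤ n + m) (sym (Listₚ.length-++ W)) (ℕₚ.+-mono-≤ size B≤m))))

        col′ : Coloring G (suc s)
        col′ v with v ∈? N
        ... | yes _ = i
        ... | no  _ = col v

        col′-∈ : ∀ {v} → v ∈ N → col′ v ≡ i
        col′-∈ {v} v∈ with v ∈? N
        ... | yes _  = refl
        ... | no  v∉ = contradiction v∈ v∉

        col′-∉ : ∀ {v} → v ∉ N → col′ v ≡ col v
        col′-∉ {v} v∉ with v ∈? N
        ... | yes v∈ = contradiction v∈ v∉
        ... | no  _  = refl

        Y∉N : ∀ {v} → v ∈ Y → v ∉ N
        Y∉N v∈Y v∈N = let zv , v∉W , _ = N∋ v∈N in ∉Y zv v∉W v∈Y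

        col-B : ∀ {v} → v ∈ B → col v ≡ c₀ v
        col-B v∈ = unchanged λ v∈W → disjoint v∈ (W⊆Z v∈W)

        B⊆Y : ∀ {v} → v ∈ B → v ∈ Y × c₀ v ≡ col v
        B⊆Y v∈ = ∈-++⁺ʳ W v∈ , sym (col-B v∈)

        avoids-N : ∀ {w o} → o ∈ O → Adjacent G w o → w ∈ N → col′ w ≢ c₀ o
        avoids-N o∈ a w∈ eq = let _ , _ , ¬sees , _ = N∋ w∈ in
          ¬sees (_ , o∈ , a , trans (sym eq) (col′-∈ w∈))

        avoids-W : ∀ {w o} → o ∈ O → Adjacent G w o → w ∈ W → col′ w ≢ c₀ o
        avoids-W o∈ a w∈ eq = avoids w∈ o∈ a
          (trans (sym (col′-∉ (Y∉N (∈-++⁺ˡ w∈)))) eq)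

        rich′ : ∀ {z j} → Z z → z ∉ N ++ W → Rich c₀ B z → j ∈ i ∷ done → Sees c₀ O z j
        -- A vertex rich to `B` is also rich to `W ++ B`, so only a neighbour of colour `i` in `O`
        -- can have kept it out of `N`.
        rich′ zz z∉ r (here refl) = decidable-stable (sees? c₀ O _ i) λ ¬sees →
          z∉ (∈-++⁺ˡ (∈N (zz , z∉ ∘ ∈-++⁺ʳ N , ¬sees , Rich-mono B⊆Y r)))
        rich′ zz z∉ r (there j∈)  = rich zz (z∉ ∘ ∈-++⁺ʳ N) r j∈

        Sees-old : ∀ {z k} → k ≢ i → Sees col′ ((N ++ W) ++ B) z k → Sees col Y z k
        Sees-old k≢i (u , u∈ , a , refl) with u ∈? N
        ... | yes u∈N = contradiction refl k≢i
        ... | no  u∉N =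
          u , [ (λ u∈NW → [ (λ u∈N → contradiction u∈N u∉N) , ∈-++⁺ˡ ]′ (∈-++⁻ N u∈NW))
              , ∈-++⁺ʳ W ]′ (∈-++⁻ (N ++ W) u∈)
            , a , refl

        -- A vertex that stays uncoloured although it is rich already sees i on O.
        free′ : ∀ {z} → Z z → z ∉ N ++ W → ¬ Rich c₀ B z → Free col′ ((N ++ W) ++ B) z
        free′ {z} zz z∉ ¬r with rich? col Y z
        ... | no ¬rY = let j , j≢i , ¬sees = poor⇒free ¬rY i in j , ¬sees ∘ Sees-old j≢i
        ... | yes rY =
          let z∉W       = z∉ ∘ ∈-++⁺ʳ N
              j , ¬sees = free-Partial zz z∉W ¬r
              sees-i    = decidable-stable (sees? c₀ O z i) λ ¬s →
                            z∉ (∈-++⁺ˡ (∈N (zz , z∉W , ¬s , rY)))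
          in j , ¬sees ∘ Sees-old λ eq →
               ¬sees (subst (Sees col Y z) (sym eq) (Sees-mono (B⊆Y ∘ O⊆B) sees-i))

        source-Rich : ∀ {v} → New v → ∃[ r ] (Z r × Rich c₀ B r)
        -- If `W` is empty, richness to `W ++ B` is richness to `B`; otherwise an earlier round has
        -- a source.
        source-Rich {v} (zv , _ , _ , r) with W in eq
        ... | x ∷ _ = source (subst (x ∈_) (sym eq) (here refl))
        ... | []    = v , zv , Rich-mono (λ u∈ → u∈ , col-B u∈) r

      rounds : ∀ is → Partial piece is (roundsBound s t m (length is))
      rounds []       = start
      rounds (i ∷ is) = round i (rounds is)

    -- The recursion over separators.

    module Extend (m x : ℕ)
                  -- `Y` will be one vertex `z₀` together with `W ++ B`, whence the successor. The
                  -- same `m` bounds `B` and the boundaries of the parts, so no bound grows along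
                  -- the recursion.
                  (separation : ∀ Y → length Y ≤ suc (roundsBound s t m (suc s) + m) →
                                Separation G Y x m) where

      private
        φ = roundsBound s t m (suc s)
        η = islandBound s t m x

      -- Closed under monochromatic edges, hence a superset of the component of `z`; it may contain
      -- several components.
      record Island (Z : V → Set) (c : Coloring G (suc s)) (z : V) : Set where
        field
          list   : List V
          size   : length list ≤ η
          member : z ∈ list
          list⊆Z : ∀ {x} → x ∈ list → Z x
          closed : ∀ {x y} → x ∈ list → Adjacent G x y → c x ≡ c y → y ∈ list

      -- Monochromatic edges between `Z` and `B` can only join `W` to vertices of `B` outside `O`.
      -- Vertices of `W` get no island here, as their components may leave `Z`; they are central one
      -- level higher.
      record Extension (Z : V → Set) (c₀ : Coloring G (suc s)) (B O : List V) : Set where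
        field
          col       : Coloring G (suc s)
          W         : List V
          W⊆Z       : ∀ {w} → w ∈ W → Z w
          size      : length W ≤ φ
          source    : ∀ {w} → w ∈ W → ∃[ r ] (Z r × Rich c₀ B r)
          unchanged : ∀ {v} → ¬ Z v → col v ≡ c₀ v
          W-avoids  : ∀ {w o} → w ∈ W → o ∈ O → Adjacent G w o → col w ≢ c₀ o
          avoids    : ∀ {z u} → Z z → z ∉ W → u ∈ W ++ B → Adjacent G z u → col z ≢ col u
          island    : ∀ {z} → Z z → z ∉ W → Island Z col z

      open Extension

      module Step {Z c₀ B O} (z₀ : V) (piece : Piece Z c₀ B O) (B≤m : length B ≤ m) where

        open Piece piece

        opaque
          P : Partial piece (allFin (suc s)) φ
          P = subst (λ k → Partial piece (allFin (suc s)) (roundsBound s t m k))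
                (Listₚ.length-tabulate {n = suc s} id) (rounds piece B≤m (allFin (suc s)))

        W₁ : List V
        W₁ = Partial.W P

        W₁⊆Z : ∀ {w} → w ∈ W₁ → Z w
        W₁⊆Z = Partial.W⊆Z P

        c₁ : Coloring G (suc s)
        c₁ = Partial.col P

        Y : List V
        Y = W₁ ++ B

        free₁ : ∀ {z} → Z z → z ∉ W₁ → Free c₁ Y z
        free₁ {z} zz z∉ with rich? c₀ B z
        ... | no ¬r = Partial.free P zz z∉ ¬r
        ... | yes r = let i , ¬sees = free zz in
          contradiction (Partial.rich P zz z∉ r (∈-allFin i)) ¬sees

        opaque
          -- All of `Z` outside `W₁` receives a colour unseen on `Y`, but only the choices in the
          -- separator survive; in the parts they are placeholders.
          recolour : ∀ v → ∃[ i ] ((Z v → v ∉ W₁ → ¬ Sees c₁ Y v i) × (¬ Z v ⊎ v ∈ W₁ → i ≡ c₁ v))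
          recolour v with Z? v | v ∈? W₁
          ... | no ¬zv | _      = c₁ v , (λ zv → contradiction zv ¬zv) , λ _ → refl
          ... | yes _  | yes v∈ = c₁ v , (λ _ v∉ → contradiction v∈ v∉) , λ _ → refl
          ... | yes zv | no v∉  = let i , ¬sees = free₁ zv v∉ in
            i , (λ _ _ → ¬sees) , [ contradiction zv , (λ v∈ → contradiction v∈ v∉) ]′

        c₂ : Coloring G (suc s)
        c₂ v = proj₁ (recolour v)

        c₂-new : ∀ {v} → Z v → v ∉ W₁ → ¬ Sees c₁ Y v (c₂ v)
        c₂-new {v} = proj₁ (proj₂ (recolour v))

        c₂-old : ∀ {v} → ¬ Z v ⊎ v ∈ W₁ → c₂ v ≡ c₁ v
        c₂-old {v} = proj₂ (proj₂ (recolour v))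

        c₂-Y : ∀ {v} → v ∈ Y → c₂ v ≡ c₁ v
        c₂-Y = c₂-old ∘ [ inj₂ , inj₁ ∘ disjoint ]′ ∘ ∈-++⁻ W₁

        opaque
          S : Separation G (z₀ ∷ Y) x m
          S = separation (z₀ ∷ Y) (s≤s (subst (_≤ φ + m) (sym (Listₚ.length-++ W₁))
                (ℕₚ.+-mono-≤ (Partial.size P) B≤m)))

        open Separation S using (part; part-adjacent) renaming (separator to X)

        Y⊆X : ∀ {y} → y ∈ Y → y ∈ X
        Y⊆X = Separation.Y⊆separator S ∘ there

        z₀∈X : z₀ ∈ X
        z₀∈X = Separation.Y⊆separator S (here refl)

        Part : Fin (Separation.#parts S) → V → Set
        Part p v = Z v × v ∉ X × part v ≡ p

        module _ (p : Fin (Separation.#parts S)) where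

          boundaryList = Separation.boundary S p

          Bₚ : List V
          Bₚ = filter (_∈? X) (proj₁ boundaryList)

          -- `free₁` speaks of `Y` only, so inside the part a free colour is guaranteed for just
          -- this portion of the boundary.
          Oₚ : List V
          Oₚ = filter (_∈? Y) Bₚ

          Bₚ⊆X : ∀ {u} → u ∈ Bₚ → u ∈ X
          Bₚ⊆X u∈ = proj₂ (∈-filter⁻ (_∈? X) {xs = proj₁ boundaryList} u∈)

          length-Bₚ : length Bₚ ≤ m
          length-Bₚ = ℕₚ.≤-trans (Listₚ.length-filter (_∈? X) (proj₁ boundaryList))
                        (proj₁ (proj₂ boundaryList))

          ∈Bₚ : ∀ {z u} → Part p z → u ∈ X → Adjacent G z u → u ∈ Bₚ
          ∈Bₚ (_ , z∉ , eq) u∈ a =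
            ∈-filter⁺ (_∈? X) (proj₂ (proj₂ boundaryList) (u∈ , _ , z∉ , eq , a)) u∈

          pieceₚ : Piece (Part p) c₂ Bₚ Oₚ
          pieceₚ = record
            { Z?       = λ v → Z? v ×-dec ¬? (v ∈? X) ×-dec (part v Finₚ.≟ p)
            ; boundary = boundaryₚ
            ; disjoint = λ u∈ (_ , u∉ , _) → u∉ (Bₚ⊆X u∈)
            ; O⊆B      = λ u∈ → proj₁ (∈-filter⁻ (_∈? Y) {xs = Bₚ} u∈)
            ; free     = λ (zz , z∉ , _) →
                let i , ¬sees = free₁ zz (z∉ ∘ Y⊆X ∘ ∈-++⁺ˡ) in
                i , ¬sees ∘ Sees-mono λ u∈ →
                  let u∈Y = proj₂ (∈-filter⁻ (_∈? Y) {xs = Bₚ} u∈) in u∈Y , c₂-Y u∈Y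
            }
            where
            boundaryₚ : ∀ {z u} → Part p z → Adjacent G z u → Part p u ⊎ u ∈ Bₚ
            boundaryₚ {z} {u} zp@(zz , z∉ , eq) a with u ∈? X
            ... | yes u∈ = inj₂ (∈Bₚ zp u∈ a)
            ... | no  u∉ = inj₁
              ( [ id , (λ u∈B → contradiction (Y⊆X (∈-++⁺ʳ W₁ u∈B)) u∉) ]′ (boundary zz a)
              , u∉ , trans (sym (part-adjacent z∉ u∉ a)) eq )

        module Combine (extension : ∀ p → Extension (Part p) c₂ (Bₚ p) (Oₚ p)) where

          outer? : ∀ v → Dec (Z v × v ∉ X)
          outer? v = Z? v ×-dec ¬? (v ∈? X)

          opaque
            c₃ : Coloring G (suc s)
            c₃ v with outer? v
            ... | yes _ = col (extension (part v)) v
            ... | no  _ = c₂ v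

            c₃-out : ∀ {v} → ¬ (Z v × v ∉ X) → c₃ v ≡ c₂ v
            c₃-out {v} ¬o with outer? v
            ... | yes o = contradiction o ¬o
            ... | no  _ = refl

            c₃-part : ∀ {p v} → Part p v → c₃ v ≡ col (extension p) v
            c₃-part {v = v} (zv , v∉ , refl) with outer? v
            ... | yes _ = refl
            ... | no ¬o = contradiction (zv , v∉) ¬o

          c₃-X : ∀ {v} → v ∈ X → c₃ v ≡ c₂ v
          c₃-X v∈ = c₃-out λ (_ , v∉) → v∉ v∈

          c₃-Y : ∀ {v} → v ∈ Y → c₃ v ≡ c₁ v
          c₃-Y v∈ = trans (c₃-X (Y⊆X v∈)) (c₂-Y v∈)

          c₃-X-part : ∀ p {v} → v ∈ X → c₃ v ≡ col (extension p) v
          c₃-X-part p v∈ = trans (c₃-X v∈) (sym (unchanged (extension p) λ (_ , v∉ , _) → v∉ v∈))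

          -- In the separator this is the choice of `c₂`; in the `W` of a part, `u` reappears in
          -- `Oₚ`; elsewhere in a part, `u` reappears in `Bₚ`.
          avoids₃ : ∀ {z u} → Z z → z ∉ W₁ → u ∈ Y → Adjacent G z u → c₃ z ≢ c₃ u
          avoids₃ {z} {u} zz z∉W u∈ a eq with z ∈? X
          ... | yes z∈X = c₂-new zz z∉W
            (u , u∈ , a , trans (sym (c₃-Y u∈)) (trans (sym eq) (c₃-X z∈X)))
          ... | no  z∉X with z ∈? W (extension (part z))
          ...   | yes z∈W = W-avoids (extension _) z∈W
            (∈-filter⁺ (_∈? Y) (∈Bₚ _ (zz , z∉X , refl) (Y⊆X u∈) a) u∈) a
            (trans (sym (c₃-part (zz , z∉X , refl))) (trans eq (c₃-X (Y⊆X u∈))))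
          ...   | no  z∉Wₚ = avoids (extension _) (zz , z∉X , refl) z∉Wₚ
            (∈-++⁺ʳ (W (extension _)) (∈Bₚ _ (zz , z∉X , refl) (Y⊆X u∈) a)) a
            (trans (sym (c₃-part (zz , z∉X , refl))) (trans eq (c₃-X-part _ (Y⊆X u∈))))

          Central : V → Set
          Central v = Z v × v ∉ W₁ × (v ∈ X ⊎ v ∈ W (extension (part v)))

          central? : Decidable Central
          central? v = Z? v ×-dec ¬? (v ∈? W₁) ×-dec ((v ∈? X) ⊎-dec (v ∈? W (extension (part v))))

          -- Boundedly many parts have a nonempty W, since each of those contains a vertex
          -- that is rich to X.
          Central-Covered : Covered Central η
          Central-Covered =
            let rs , rs≤ , rs∋ = Rich-Covered c₂ X
                ys , ys≤ , ys∋ = Covered-⋃ {P = λ r v → v ∈ W (extension (part r))} rs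
                                   λ r → W (extension (part r)) , size (extension (part r)) , id
            in X ++ ys
             , subst (_≤ η) (sym (Listₚ.length-++ X))
                 (ℕₚ.+-mono-≤ (Separation.size S) (ℕₚ.≤-trans ys≤ (ℕₚ.*-monoˡ-≤ φ
                   (ℕₚ.≤-trans rs≤ (richBound-mono s t (Separation.size S))))))
             , λ { (_ , _ , inj₁ v∈X) → ∈-++⁺ˡ v∈X
                 ; {v} (_ , _ , inj₂ v∈W) →
                     let r , (_ , r∉X , eq) , rich = source (extension (part v)) v∈W
                     in ∈-++⁺ʳ X (ys∋ (r
                          , rs∋ (r∉X , Rich-mono (λ u∈ → Bₚ⊆X _ u∈ , refl) rich)
                          , subst (λ p → v ∈ W (extension p)) (sym eq) v∈W)) }

          -- By `avoids₃`, `y` is not in `Y`, so it stays in `Z` outside `W₁`. Were it in a part but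
          -- outside the `W` of that part, then `x`, lying in the boundary or in the `W` of the same
          -- part, could not share its colour.
          Central-closed : ∀ {x y} → Central x → Adjacent G x y → c₃ x ≡ c₃ y → Central y
          Central-closed {x} {y} (zx , x∉W , x∈) a eq = zy , y∉Y ∘ ∈-++⁺ˡ , y∈
            where
            y∉Y : y ∉ Y
            y∉Y y∈Y = avoids₃ zx x∉W y∈Y a eq

            zy : Z y
            zy = [ id , (λ y∈B → contradiction (∈-++⁺ʳ W₁ y∈B) y∉Y) ]′ (boundary zx a)

            y∈ : y ∈ X ⊎ y ∈ W (extension (part y))
            y∈ with y ∈? X | y ∈? W (extension (part y))
            ... | yes y∈X | _       = inj₁ y∈X
            ... | no _    | yes y∈W = inj₂ y∈W
            ... | no y∉X  | no y∉Wₚ =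
              contradiction (trans (sym (c₃-part yp)) (trans (sym eq) c₃-x))
                (avoids (extension (part y)) yp y∉Wₚ (proj₁ x-near) (Adjacent-sym G a))
              where
              yp : Part (part y) y
              yp = zy , y∉X , refl

              Near : Set
              Near = x ∈ W (extension (part y)) ++ Bₚ (part y) × c₃ x ≡ col (extension (part y)) x

              near : Dec (x ∈ X) → x ∈ X ⊎ x ∈ W (extension (part x)) → Near
              near (no x∉X)  (inj₁ x∈X) = contradiction x∈X x∉X
              near (no x∉X)  (inj₂ x∈W) =
                let same = part-adjacent x∉X y∉X a in
                ∈-++⁺ˡ (subst (λ p → x ∈ W (extension p)) same x∈W) , c₃-part (zx , x∉X , same)
              near (yes x∈X) _          =
                ∈-++⁺ʳ (W (extension (part y))) (∈Bₚ (part y) yp x∈X (Adjacent-sym G a))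
                , c₃-X-part (part y) x∈X

              x-near : Near
              x-near = near (x ∈? X) x∈

              c₃-x = proj₂ x-near

          central-island : ∀ {z} → Central z → Island Z c₃ z
          central-island cz = record
            { list   = filter central? xs
            ; size   = ℕₚ.≤-trans (Listₚ.length-filter central? xs) (proj₁ (proj₂ Central-Covered))
            ; member = ∈L cz
            ; list⊆Z = proj₁ ∘ L∋
            ; closed = λ x∈ a eq → ∈L (Central-closed (L∋ x∈) a eq)
            }
            where
            xs = proj₁ Central-Covered

            L∋ : ∀ {x} → x ∈ filter central? xs → Central x
            L∋ x∈ = proj₂ (∈-filter⁻ central? {xs = xs} x∈)

            ∈L : ∀ {x} → Central x → x ∈ filter central? xs
            ∈L cx = ∈-filter⁺ central? (proj₂ (proj₂ Central-Covered) cx) cx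

          -- Neighbours of the part lie in it or in `Bₚ`, and in both places `c₃` agrees with the
          -- colouring of the extension.
          part-island : ∀ p {z} → Island (Part p) (col (extension p)) z → Island Z c₃ z
          part-island p I = record
            { list   = list
            ; size   = Island.size I
            ; member = member
            ; list⊆Z = proj₁ ∘ list⊆Z
            ; closed = λ x∈ a eq → closed x∈ a (trans (sym (c₃-part (list⊆Z x∈))) (trans eq
                ([ c₃-part , c₃-X-part p ∘ Bₚ⊆X p ]′ (Piece.boundary (pieceₚ p) (list⊆Z x∈) a))))
            }
            where open Island I

          island₃ : ∀ {z} → Z z → z ∉ W₁ → Island Z c₃ z
          island₃ {z} zz z∉W with z ∈? X | z ∈? W (extension (part z))
          ... | yes z∈X | _       = central-island (zz , z∉W , inj₁ z∈X)
          ... | no _    | yes z∈W = central-island (zz , z∉W , inj₂ z∈W)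
          ... | no z∉X  | no z∉Wₚ =
            part-island (part z) (island (extension (part z)) (zz , z∉X , refl) z∉Wₚ)

          combined : Extension Z c₀ B O
          combined = record
            { col       = c₃
            ; W         = W₁
            ; W⊆Z       = W₁⊆Z
            ; size      = Partial.size P
            ; source    = Partial.source P
            ; unchanged = λ ¬zv → trans (c₃-out (¬zv ∘ proj₁))
                            (trans (c₂-old (inj₁ ¬zv)) (Partial.unchanged P (¬zv ∘ W₁⊆Z)))
            ; W-avoids  = λ w∈ o∈ a eq → Partial.avoids P w∈ o∈ a
                            (trans (sym (c₃-Y (∈-++⁺ˡ w∈))) eq)
            ; avoids    = avoids₃
            ; island    = island₃
            }

      -- Induction on a list containing `Z`: its head `z₀` goes into the separator, so every part is
      -- contained in the tail.
      extend : ∀ l {Z c₀ B O} → Piece Z c₀ B O → length B ≤ m → (∀ {z} → Z z → z ∈ l) →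
               Extension Z c₀ B O
      extend [] {c₀ = c₀} piece B≤m Z⊆[] = record
        { col       = c₀
        ; W         = []
        ; W⊆Z       = λ ()
        ; size      = z≤n
        ; source    = λ ()
        ; unchanged = λ _ → refl
        ; W-avoids  = λ ()
        ; avoids    = λ zz → contradiction (Z⊆[] zz) λ ()
        ; island    = λ zz → contradiction (Z⊆[] zz) λ ()
        }
      extend (z₀ ∷ l) piece B≤m Z⊆ = Combine.combined λ p → extend l (pieceₚ p) (length-Bₚ p)
        λ (zz , z∉ , _) → case Z⊆ zz of λ
          { (here refl) → contradiction z₀∈X z∉
          ; (there z∈)  → z∈ }
        where open Step z₀ piece B≤m

-- Clustering of the whole graph.

clusteringBound : ℕ → ℕ → ℕ → ℕ
-- `m` is the size of two bags, `n` bounds `z₀` with `W ++ B`, and `n * n * suc w` is the size of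
-- the separator. The outer `suc` makes the bound positive at sight.
clusteringBound s t w = suc (islandBound s t m (n * n * suc w))
  where
  m = suc w + suc w
  n = suc (roundsBound s t m (suc s) + m)

clusteredColouring : ∀ {s t w} → 1 ≤ s → 1 ≤ t → (G : Graph) → Treewidth≤ G w → ¬ (K s t ⊑ G) →
                     ColorableWithClustering G (suc s) (clusteringBound s t w)
clusteredColouring {s} {t} {w} 1≤s 1≤t G (D , width≤w) K⋢G = col , clustered
  where
  open Colours G s
  open Extend 1≤t K⋢G (suc w + suc w) _ (separate G D width≤w)

  c₀ : Coloring G (suc s)
  c₀ _ = zero

  whole : Piece U c₀ [] []
  whole = record
    { Z?       = λ _ → yes tt
    ; boundary = λ _ _ → inj₁ tt
    ; disjoint = λ ()
    ; O⊆B      = λ ()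
    ; free     = λ _ → zero , λ { (_ , () , _) }
    }

  open Extension (extend (allFin (#V G)) whole z≤n (λ _ → ∈-allFin _))

  -- As `1 ≤ s`, there is a colour besides `i`, and it cannot be seen on the empty set. By `source`,
  -- the outermost `W` is therefore empty, and every vertex has an island.
  nothing-rich : ∀ {v} → ¬ Rich c₀ [] v
  nothing-rich (i , r) with r (punchIn i (fromℕ< 1≤s)) (Finₚ.punchInᵢ≢i i _)
  ... | _ , () , _

  clustered : HasClustering G col _
  clustered C (i , comp) =
    let v , v∈C = IsComponent.nonempty comp
        I       = island {v} tt λ v∈W → nothing-rich (proj₂ (proj₂ (source v∈W)))
    in ℕₚ.m≤n⇒m≤1+n (Covered⇒∣p∣≤
         (Island.list I , Island.size I , λ u∈C →
           reach I (Island.member I) (IsComponent.connected comp v∈C u∈C)))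
    where
    reach : ∀ {v x y} (I : Island U col v) → x ∈ Island.list I →
            Star (λ x y → x ∈ₛ C × y ∈ₛ C × Adjacent G x y) x y → y ∈ Island.list I
    reach I x∈ ε = x∈
    reach I x∈ ((p , q , a) ◅ path) = reach I
      (Island.closed I x∈ a (trans (IsComponent.inside comp p) (sym (IsComponent.inside comp q)))) path

theorem4 : ∀ (s t w : ℕ) → 1 ≤ s → 1 ≤ t → 1 ≤ w →
    ∃[ η ] (1 ≤ η × (∀ (G : Graph) → Treewidth≤ G w → ¬ (K s t ⊑ G) →
    ColorableWithClustering G (s + 1) η))
theorem4 s t w 1≤s 1≤t _ = clusteringBound s t w , s≤s z≤n , λ G tw≤w K⋢G →
  subst (λ k → ColorableWithClustering G k (clusteringBound s t w)) (ℕₚ.+-comm 1 s)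
    (clusteredColouring 1≤s 1≤t G tw≤w K⋢G)
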